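{- Let $\sigma,n\ge2$ be integers with $\sigma\le n$. Any data structure supporting special rank queries for every string $T\in[0..\sigma)^n$ has worst-case space usage $\Omega(n\log\sigma)$ bits; that is, there is an absolute constant $\delta>0$ such that for all integers $2\le\sigma\le n$, any such data structure uses at least $\delta\, n\log\sigma$ bits on some string $T\in[0..\sigma)^n$.
   Context: Here $[0..\sigma)=\{0,\dots,\sigma-1\}$ and $\log$ is base 2. For a string $T$ of length $n$ and $j\in\{1,\dots,n\}$, the special rank query returns $\mathsf{special\text{ - }rank}_T(j)=|\{i\in\{1,\dots,j\}:T[i]=T[j]\}|$. A data structure supporting a query problem for a family of inputs (with parameters $\sigma,n$ fixed) assigns to each input a finite bit string; the answer to every query on an input is determined by the stored bit string and the query arguments only. The space used on an input is the length of its bit string, and the worst-case space usage is the maximum over all inputs in the family. Query time is irrelevant. -}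

module Defs where

open import Data.Bool using (Bool)
open import Data.Fin using (Fin)
open import Data.Fin.Properties using (_≟_; _≤?_)
open import Data.Integer using (∣_∣)
open import Data.List using (List; length)
open import Data.Nat as ℕ using (ℕ; _*_; _^_)
open import Data.Rational using (ℚ; ↥_; ↧ₙ_)
open import Data.Vec using (Vec; lookup; count; allFin)
open import Relation.Binary.PropositionalEquality using (_≡_)
open import Relation.Nullary.Decidable using (_×-dec_)

-- Strings over the alphabet [0..σ); position j ∈ {1,…,n} is the element j - 1
-- of Fin n.
Str : ℕ → ℕ → Set
Str σ n = Vec (Fin σ) n

specialRank : ∀ {σ n} → Str σ n → Fin n → ℕ
specialRank {n = n} T j =
  count (λ i → (i ≤? j) ×-dec (lookup T i ≟ lookup T j)) (allFin n)

-- The answer may depend on the input only through its stored bit string.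
-- Bit strings of different inputs may have different lengths.
record DataStructure {Input Query Answer : Set}
                     (problem : Input → Query → Answer) : Set where
  field
    encode  : Input → List Bool
    answer  : List Bool → Query → Answer
    correct : ∀ x q → answer (encode x) q ≡ problem x q

  space : Input → ℕ
  space x = length (encode x)

SpecialRankDS : ℕ → ℕ → Set
SpecialRankDS σ n = DataStructure (specialRank {σ} {n})

-- s ≥[ δ ] n log₂ σ is the real inequality s ≥ δ n log₂ σ, for rational δ ≥ 0
-- and σ ≥ 1.  With δ = p / q it reads p n log₂ σ ≤ q s; exponentiating in base 2
-- gives σ ^ (p n) ≤ 2 ^ (q s).
_≥[_]_log₂_ : ℕ → ℚ → ℕ → ℕ → Set
s ≥[ δ ] n log₂ σ = σ ^ (∣ ↥ δ ∣ * n) ℕ.≤ 2 ^ (↧ₙ δ * s)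

{-# OPTIONS --safe #-}
module Submission where

-- Let h ≥ 1 with 2h ≤ σ.  In a word that starts with a prefix in which each letter
-- a < 2h occurs exactly a times, followed by blocks that are permutations of these
-- 2h letters, the letter a has special rank a + t + 1 in the t-th block (t ≥ 0), so
-- the special ranks determine all the blocks.  At least (h + 1) ^ h permutations are
-- available for each block.  For h maximal with 2h ≤ σ and 3h² ≤ n, one has
-- σ ≤ (h + 1) ^ 4, and there is room for k blocks with n ≤ 7hk; hence σ ^ n is at
-- most the 28th power of the number M = (h + 1) ^ (hk) of words.  Encodings of M
-- words pairwise separated by their ranks are distinct, so some length s satisfies
-- M < 2 ^ (s + 1) ≤ 2 ^ (2s).  The remaining case σ = n = 2 is checked by hand.

open import Defs
open import Data.Bool using (Bool; true; false; _∧_)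
open import Data.Fin as Fin
  using (Fin; zero; suc; toℕ; fromℕ<; _↑ˡ_; _↑ʳ_; inject≤; finToFun; funToFin; combine)
open import Data.Fin.Properties
  using (_≟_; _≤?_; any?; toℕ-injective; fromℕ<-injective; inject≤-injective;
         injective⇒≤; funToFin-finToFin; suc-injective)
import Data.Integer as ℤ
open import Data.List using (List; []; _∷_; length)
open import Data.Nat as ℕ using (ℕ; zero; suc; _+_; _*_; _∸_; _^_; _≤_; z≤n; s≤s)
open import Data.Nat.Binary as Binary using (ℕᵇ; 2[1+_]; 1+[2_])
open import Data.Nat.Binary.Properties as Binaryₚ using (2[1+_]-injective; 1+[2_]-injective)
open import Data.Nat.DivMod using (m≡m%n+[m/n]*n; m%n<n)
open import Data.Nat.Properties hiding (_≟_; _≤?_; suc-injective)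
open import Data.Nat.Tactic.RingSolver using (solve-∀)
open import Data.Product using (Σ-syntax; ∃-syntax; _×_; _,_; proj₁; proj₂)
open import Data.Rational using (0ℚ; _<_; _/_)
open import Data.Rational.Properties using (positive⁻¹)
open import Data.Vec
  using (Vec; []; _∷_; _++_; lookup; count; concat; replicate; tabulate; allFin; map; insertAt)
open import Data.Vec.Properties
  using (lookup-map; lookup-++ˡ; lookup-++ʳ; tabulate∘lookup; tabulate-cong; ∷-injective)
open import Function using (_∘_; id)
open import Function.Bundles using (mk⇔)
open import Relation.Binary.PropositionalEquality
open import Relation.Nullary using (¬_; Dec; yes; no; does; contradiction)
open import Relation.Nullary.Decidable using (_×-dec_; does-⇔; dec-true)
open import Relation.Unary using (Decidable)

private variable
  A B : Set
  k m n σ τ : ℕ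

-- Counting occurrences of a letter.

occ : Fin σ → Vec (Fin σ) n → ℕ
occ a = count (_≟ a)

-- Keeps the contribution of the head as a number, so that later proofs can rearrange sums instead
-- of splitting on `b ≟ a`.
occ-∷ : (a b : Fin σ) (v : Vec (Fin σ) n) → occ a (b ∷ v) ≡ occ a (b ∷ []) + occ a v
occ-∷ a b v with does (b ≟ a)
... | true  = refl
... | false = refl

occ-++ : (a : Fin σ) (u : Vec (Fin σ) m) (v : Vec (Fin σ) n) →
         occ a (u ++ v) ≡ occ a u + occ a v
occ-++ a []      v = refl
occ-++ a (b ∷ u) v with does (b ≟ a)
... | true  = cong suc (occ-++ a u v)
... | false = occ-++ a u v

occ-insertAt : (a b : Fin σ) (v : Vec (Fin σ) n) (i : Fin (suc n)) →
               occ a (insertAt v i b) ≡ occ a (b ∷ v)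
occ-insertAt a b v       zero    = refl
occ-insertAt a b (x ∷ v) (suc i)
  rewrite occ-∷ a x (insertAt v i b) | occ-insertAt a b v i
        | occ-∷ a b v | occ-∷ a b (x ∷ v) | occ-∷ a x v
  = lemma (occ a (x ∷ [])) (occ a (b ∷ [])) (occ a v)
  where
  lemma : ∀ x y z → x + (y + z) ≡ y + (x + z)
  lemma = solve-∀

occ-zero-map-suc : (v : Vec (Fin σ) n) → occ zero (map suc v) ≡ 0
occ-zero-map-suc []      = refl
occ-zero-map-suc (b ∷ v) = occ-zero-map-suc v

occ-map : {f : Fin σ → Fin τ} → (∀ {x y} → f x ≡ f y → x ≡ y) →
          (a : Fin σ) (v : Vec (Fin σ) n) → occ (f a) (map f v) ≡ occ a v
occ-map         inj a []      = refl
occ-map {f = f} inj a (b ∷ v)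
  rewrite does-⇔ (mk⇔ inj (cong f)) (f b ≟ f a) (b ≟ a) with does (b ≟ a)
... | true  = cong suc (occ-map inj a v)
... | false = occ-map inj a v

count-tabulate : {P : A → Set} {Q : B → Set} (P? : Decidable P) (Q? : Decidable Q)
                 {f : Fin n → A} {g : Fin n → B} →
                 (∀ i → does (P? (f i)) ≡ does (Q? (g i))) →
                 count P? (tabulate f) ≡ count Q? (tabulate g)
count-tabulate {n = zero}  P? Q? eq = refl
count-tabulate {n = suc n} P? Q? {f} {g} eq
  rewrite eq zero with does (Q? (g zero))
... | true  = cong suc (count-tabulate P? Q? (eq ∘ suc))
... | false = count-tabulate P? Q? (eq ∘ suc)

count-none : {P : A → Set} (P? : Decidable P) {f : Fin n → A} →
             (∀ i → does (P? (f i)) ≡ false) → count P? (tabulate f) ≡ 0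
count-none {n = zero}  P? eq = refl
count-none {n = suc n} P? eq rewrite eq zero = count-none P? (eq ∘ suc)

-- Special ranks under prepending, relabelling and concatenation.

specialRank-zero : (a : Fin σ) (T : Str σ n) → specialRank (a ∷ T) zero ≡ 1
specialRank-zero {n = n} a T rewrite dec-true (a ≟ a) refl =
  cong suc (count-none (λ i → (i ≤? Fin.zero {n}) ×-dec (lookup (a ∷ T) i ≟ a)) {f = Fin.suc} (λ _ → refl))

-- The new first position lies before every other one, so it adds one exactly when its letter is the
-- queried letter; the order among the remaining positions is unchanged.
specialRank-suc : (a : Fin σ) (T : Str σ n) (j : Fin n) →
  specialRank (a ∷ T) (suc j) ≡ occ (lookup T j) (a ∷ []) + specialRank T j
specialRank-suc {σ} {n} a T j = trans head (cong (occ b (a ∷ []) +_) tail)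
  where
  b = lookup T j
  P? : (i : Fin (suc n)) → Dec _
  P? = λ i → (i ≤? suc j) ×-dec (lookup (a ∷ T) i ≟ b)
  head : specialRank (a ∷ T) (suc j) ≡ occ b (a ∷ []) + count P? (tabulate suc)
  head with does (a ≟ b)
  ... | true  = refl
  ... | false = refl
  ≤?-suc : (i : Fin n) → does (suc i ≤? suc j) ≡ does (i ≤? j)
  ≤?-suc zero    = refl
  ≤?-suc (suc i) = refl
  tail : count P? (tabulate suc) ≡ specialRank T j
  tail = count-tabulate P? (λ i → (i ≤? j) ×-dec (lookup T i ≟ b))
           (λ i → cong (_∧ does (lookup T i ≟ b)) (≤?-suc i))

-- Special rank sees letters only through which positions agree, and an injective relabelling
-- preserves that.
specialRank-map : {f : Fin σ → Fin τ} → (∀ {x y} → f x ≡ f y → x ≡ y) →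
                  (T : Str σ n) (j : Fin n) → specialRank (map f T) j ≡ specialRank T j
specialRank-map {f = f} inj T j = count-tabulate
  (λ i → (i ≤? j) ×-dec (lookup (map f T) i ≟ lookup (map f T) j))
  (λ i → (i ≤? j) ×-dec (lookup T i ≟ lookup T j))
  (λ i → cong (does (i ≤? j) ∧_) (same-letter i))
  where
  same-letter : ∀ i → does (lookup (map f T) i ≟ lookup (map f T) j) ≡
                      does (lookup T i ≟ lookup T j)
  same-letter i rewrite lookup-map i f T | lookup-map j f T =
    does-⇔ (mk⇔ inj (cong f)) (f (lookup T i) ≟ f (lookup T j)) (lookup T i ≟ lookup T j)

specialRank-++ˡ : (U : Str σ m) (V : Str σ n) (j : Fin m) →
                  specialRank (U ++ V) (j ↑ˡ n) ≡ specialRank U j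
specialRank-++ˡ (a ∷ U) V zero = trans (specialRank-zero a (U ++ V)) (sym (specialRank-zero a U))
specialRank-++ˡ {n = n} (a ∷ U) V (suc j)
  rewrite specialRank-suc a (U ++ V) (j ↑ˡ n) | specialRank-suc a U j
        | specialRank-++ˡ U V j | lookup-++ˡ U V j = refl

specialRank-++ʳ : (U : Str σ m) (V : Str σ n) (j : Fin n) →
                  specialRank (U ++ V) (m ↑ʳ j) ≡ occ (lookup V j) U + specialRank V j
specialRank-++ʳ []      V j = refl
specialRank-++ʳ {m = suc m} (a ∷ U) V j
  rewrite specialRank-suc a (U ++ V) (m ↑ʳ j) | specialRank-++ʳ U V j
        | lookup-++ʳ U V j | occ-∷ (lookup V j) a U =
  sym (+-assoc (occ (lookup V j) (a ∷ [])) _ _)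

-- Recovering balanced blocks from their ranks.

1≤specialRank : (T : Str σ n) (j : Fin n) → 1 ≤ specialRank T j
1≤specialRank (a ∷ T) zero    = ≤-reflexive (sym (specialRank-zero a T))
1≤specialRank (a ∷ T) (suc j) rewrite specialRank-suc a T j =
  ≤-trans (1≤specialRank T j) (m≤n+m _ _)

specialRank≤occ : (T : Str σ n) (j : Fin n) → specialRank T j ≤ occ (lookup T j) T
specialRank≤occ (a ∷ T) zero
  rewrite specialRank-zero a T | dec-true (a ≟ a) refl = s≤s z≤n
specialRank≤occ (a ∷ T) (suc j)
  rewrite specialRank-suc a T j | occ-∷ (lookup T j) a T =
  +-monoʳ-≤ (occ (lookup T j) (a ∷ [])) (specialRank≤occ T j)

-- c records how often each letter occurs before the words under consideration.
RankAfter : (Fin τ → ℕ) → Str τ n → Fin n → ℕ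
RankAfter c T j = c (lookup T j) + specialRank T j

-- Says that `B` is a permutation of the alphabet, phrased by counts, since the ranks in later
-- blocks depend on counts alone.
Balanced : Str τ n → Set
Balanced B = ∀ a → occ a B ≡ 1

Balanced⇒specialRank≡1 : (B : Str τ n) → Balanced B → ∀ j → specialRank B j ≡ 1
Balanced⇒specialRank≡1 B bal j =
  ≤-antisym (≤-trans (specialRank≤occ B j) (≤-reflexive (bal (lookup B j)))) (1≤specialRank B j)

lookup-ext : {u v : Vec A n} → (∀ i → lookup u i ≡ lookup v i) → u ≡ v
lookup-ext {u = u} {v} eq =
  trans (sym (tabulate∘lookup u)) (trans (tabulate-cong eq) (tabulate∘lookup v))

-- Inside a balanced block every own rank is 1, so position `j` shows `c (lookup B j) + 1`, and
-- injectivity of `c` recovers the letter.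
balanced-determined : {c : Fin τ → ℕ} → (∀ {a b} → c a ≡ c b → a ≡ b) →
  (B B′ : Str τ n) → Balanced B → Balanced B′ →
  (∀ j → RankAfter c B j ≡ RankAfter c B′ j) → B ≡ B′
balanced-determined {c = c} c-inj B B′ bal bal′ eq = lookup-ext λ j →
  c-inj (+-cancelʳ-≡ 1 _ _ (subst₂ (λ x y → c (lookup B j) + x ≡ c (lookup B′ j) + y)
    (Balanced⇒specialRank≡1 B bal j) (Balanced⇒specialRank≡1 B′ bal′ j) (eq j)))

RankAfter-++ˡ : (c : Fin τ → ℕ) (U : Str τ m) (V : Str τ n) (j : Fin m) →
                RankAfter c (U ++ V) (j ↑ˡ n) ≡ RankAfter c U j
RankAfter-++ˡ c U V j =
  cong₂ _+_ (cong c (lookup-++ˡ U V j)) (specialRank-++ˡ U V j)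

RankAfter-++ʳ : (c : Fin τ → ℕ) (U : Str τ m) (V : Str τ n) (j : Fin n) →
                RankAfter c (U ++ V) (m ↑ʳ j) ≡ RankAfter (λ a → c a + occ a U) V j
RankAfter-++ʳ c U V j = trans
  (cong₂ _+_ (cong c (lookup-++ʳ U V j)) (specialRank-++ʳ U V j))
  (sym (+-assoc (c (lookup V j)) _ _))

-- A balanced block raises all counts by one, so the counts stay injective after it and the blocks
-- can be recovered one by one from the left.
concat-determined : {c : Fin τ → ℕ} → (∀ {a b} → c a ≡ c b → a ≡ b) →
  (f g : Fin k → Str τ n) → (∀ i → Balanced (f i)) → (∀ i → Balanced (g i)) →
  (∀ j → RankAfter c (concat (tabulate f)) j ≡ RankAfter c (concat (tabulate g)) j) →
  ∀ i → f i ≡ g i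
concat-determined {τ} {suc k} {n} {c} c-inj f g f-bal g-bal eq = λ where
    zero    → same-head
    (suc i) → concat-determined c′-inj (f ∘ suc) (g ∘ suc) (f-bal ∘ suc) (g-bal ∘ suc) same-tail i
  where
  F = concat (tabulate (f ∘ suc))
  G = concat (tabulate (g ∘ suc))
  c′ : Fin τ → ℕ
  c′ a = c a + occ a (f zero)
  c′-inj : ∀ {a b} → c′ a ≡ c′ b → a ≡ b
  c′-inj {a} {b} e = c-inj (+-cancelʳ-≡ 1 _ _
    (subst₂ (λ x y → c a + x ≡ c b + y) (f-bal zero a) (f-bal zero b) e))
  same-head : f zero ≡ g zero
  same-head = balanced-determined c-inj (f zero) (g zero) (f-bal zero) (g-bal zero) λ j → begin
    RankAfter c (f zero) j                  ≡⟨ RankAfter-++ˡ c (f zero) F j ⟨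
    RankAfter c (f zero ++ F) (j ↑ˡ k * n)  ≡⟨ eq (j ↑ˡ k * n) ⟩
    RankAfter c (g zero ++ G) (j ↑ˡ k * n)  ≡⟨ RankAfter-++ˡ c (g zero) G j ⟩
    RankAfter c (g zero) j                  ∎
    where open ≡-Reasoning
  same-tail : ∀ j → RankAfter c′ F j ≡ RankAfter c′ G j
  same-tail j = begin
    RankAfter c′ F j                               ≡⟨ RankAfter-++ʳ c (f zero) F j ⟨
    RankAfter c (f zero ++ F) (n ↑ʳ j)             ≡⟨ eq (n ↑ʳ j) ⟩
    RankAfter c (g zero ++ G) (n ↑ʳ j)             ≡⟨ RankAfter-++ʳ c (g zero) G j ⟩
    RankAfter (λ a → c a + occ a (g zero)) G j
      ≡⟨ cong (λ B → RankAfter (λ a → c a + occ a B) G j) (sym same-head) ⟩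
    RankAfter c′ G j                               ∎
    where open ≡-Reasoning

-- A family of (m + 1) ^ k permutations of k + m letters.

allFin-balanced : ∀ τ → Balanced (allFin τ)
allFin-balanced (suc τ) zero = cong suc (count-none (_≟ zero) {f = suc {τ}} (λ _ → refl))
allFin-balanced (suc τ) (suc a) =
  trans (count-tabulate (_≟ suc a) (_≟ a) {f = suc} {g = id} (λ _ → refl)) (allFin-balanced τ a)

-- Starting from the letters k, …, k + m - 1 in increasing order, the letters
-- k - 1, …, 0 are inserted in turn, letter i at position p i.
shuffle : (Fin k → Fin (suc m)) → Str (k + m) (k + m)
shuffle {zero}  {m} p = allFin m
shuffle {suc k} {m} p =
  insertAt (map suc (shuffle (p ∘ suc))) (inject≤ (p zero) (s≤s (m≤n+m m k))) zero

shuffle-balanced : (p : Fin k → Fin (suc m)) → Balanced (shuffle p)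
shuffle-balanced {zero} {m} p = allFin-balanced m
shuffle-balanced {suc k} {m} p a = trans
  (occ-insertAt a zero (map suc S) (inject≤ (p zero) (s≤s (m≤n+m m k))))
  (split a)
  where
  S = shuffle (p ∘ suc)
  split : ∀ a → occ a (zero ∷ map suc S) ≡ 1
  split zero    = cong suc (occ-zero-map-suc S)
  split (suc a) = trans (occ-map suc-injective a S) (shuffle-balanced (p ∘ suc) a)

map-injective : {f : A → B} → (∀ {x y} → f x ≡ f y → x ≡ y) →
                (u v : Vec A n) → map f u ≡ map f v → u ≡ v
map-injective f-inj []      []      eq = refl
map-injective f-inj (x ∷ u) (y ∷ v) eq with ∷-injective eq
... | fx≡fy , eq′ = cong₂ _∷_ (f-inj fx≡fy) (map-injective f-inj u v eq′)

-- `zero` does not occur in `map suc u`, so its only occurrence in the result marks the place of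
-- insertion.
insertAt-zero-injective : (u v : Vec (Fin σ) n) (i j : Fin (suc n)) →
  insertAt {A = Fin (suc σ)} (map suc u) i zero ≡ insertAt (map suc v) j zero → i ≡ j × u ≡ v
insertAt-zero-injective u v zero zero eq =
  refl , map-injective suc-injective u v (proj₂ (∷-injective eq))
insertAt-zero-injective (x ∷ u) (y ∷ v) (suc i) (suc j) eq with ∷-injective eq
... | x≡y , eq′ with insertAt-zero-injective u v i j eq′
...   | i≡j , u≡v = cong suc i≡j , cong₂ _∷_ (suc-injective x≡y) u≡v
insertAt-zero-injective u (y ∷ v) zero (suc j) ()
insertAt-zero-injective (x ∷ u) v (suc i) zero ()

-- The place of `zero` reveals `p zero`, and deleting it leaves the shuffle of the remaining
-- choices. Every insertion has the same m + 1 places to choose from, so the choices are all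
-- functions `Fin k → Fin (suc m)`.
shuffle-injective : (p q : Fin k → Fin (suc m)) → shuffle p ≡ shuffle q → ∀ i → p i ≡ q i
shuffle-injective {suc k} {m} p q eq = λ where
    zero    → inject≤-injective _ _ (p zero) (q zero) (proj₁ split)
    (suc i) → shuffle-injective (p ∘ suc) (q ∘ suc) (proj₂ split) i
  where
  split = insertAt-zero-injective (shuffle (p ∘ suc)) (shuffle (q ∘ suc))
    (inject≤ (p zero) (s≤s (m≤n+m m k))) (inject≤ (q zero) (s≤s (m≤n+m m k))) eq

-- The prefix that gives distinct letters distinct counts.

-- The sum 0 + 1 + ... + (t - 1), that is t (t - 1) / 2.
triangle : ℕ → ℕ
triangle zero    = 0
triangle (suc t) = t + triangle t

-- Letter `a` is to occur `toℕ a` times: the shift leaves `zero` absent, and `allFin τ` adds one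
-- occurrence of every other letter.
staircase : ∀ τ → Str τ (triangle τ)
staircase zero    = []
staircase (suc τ) = map suc (allFin τ ++ staircase τ)

occ-staircase : (a : Fin τ) → occ a (staircase τ) ≡ toℕ a
occ-staircase {suc τ} zero    = occ-zero-map-suc (allFin τ ++ staircase τ)
occ-staircase {suc τ} (suc a) = begin
  occ (suc a) (map suc (allFin τ ++ staircase τ))  ≡⟨ occ-map suc-injective a (allFin τ ++ staircase τ) ⟩
  occ a (allFin τ ++ staircase τ)                  ≡⟨ occ-++ a (allFin τ) (staircase τ) ⟩
  occ a (allFin τ) + occ a (staircase τ)           ≡⟨ cong₂ _+_ (allFin-balanced τ a) (occ-staircase a) ⟩
  suc (toℕ a)                                      ∎
  where open ≡-Reasoning

-- Large families of words separated by their ranks.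

SameRanks : Str σ n → Str σ n → Set
SameRanks T U = ∀ j → specialRank T j ≡ specialRank U j

-- `funToFin` reads a function only through its values, so pointwise equality already yields equal
-- codes.
finToFun-injective : {x y : Fin (m ^ n)} →
  (∀ i → finToFun {m} {n} x i ≡ finToFun y i) → x ≡ y
finToFun-injective {m} {n} {x} {y} eq = begin
  x                                 ≡⟨ funToFin-finToFin {n} {m} x ⟨
  funToFin (finToFun {m} {n} x)     ≡⟨ funToFin-cong eq ⟩
  funToFin (finToFun {m} {n} y)     ≡⟨ funToFin-finToFin {n} {m} y ⟩
  y                                 ∎
  where
  open ≡-Reasoning
  funToFin-cong : ∀ {k} {f g : Fin k → Fin m} → (∀ i → f i ≡ g i) → funToFin f ≡ funToFin g
  funToFin-cong {zero}  eq = refl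
  funToFin-cong {suc k} eq = cong₂ combine (eq zero) (funToFin-cong (eq ∘ suc))

-- The `r` padding letters bring the word to the prescribed length; standing last, they leave the
-- ranks in the blocks unchanged.
word : (r : ℕ) → (Fin k → Str (suc τ) (suc τ)) →
       Str (suc τ) (triangle (suc τ) + (k * suc τ + r))
word {τ = τ} r f = staircase (suc τ) ++ (concat (tabulate f) ++ replicate r zero)

word-determined : ∀ r (f g : Fin k → Str (suc τ) (suc τ)) →
  (∀ i → Balanced (f i)) → (∀ i → Balanced (g i)) →
  SameRanks (word r f) (word r g) → ∀ i → f i ≡ g i
word-determined {k} {τ} r f g f-bal g-bal eq = concat-determined c-inj f g f-bal g-bal λ j →
  trans (sym (rank f j)) (trans (eq (triangle (suc τ) ↑ʳ (j ↑ˡ r))) (rank g j))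
  where
  c : Fin (suc τ) → ℕ
  c a = occ a (staircase (suc τ))
  c-inj : ∀ {a b} → c a ≡ c b → a ≡ b
  c-inj {a} {b} e =
    toℕ-injective (trans (sym (occ-staircase a)) (trans e (occ-staircase b)))
  rank : ∀ (h : Fin k → Str (suc τ) (suc τ)) j →
         specialRank (word r h) (triangle (suc τ) ↑ʳ (j ↑ˡ r)) ≡
         RankAfter c (concat (tabulate h)) j
  rank h j = trans
    -- With zero initial counts `RankAfter` computes to `specialRank`, and the counts after the
    -- prefix are `c`.
    (RankAfter-++ʳ (λ _ → 0) (staircase (suc τ)) (concat (tabulate h) ++ replicate r zero) (j ↑ˡ r))
    (RankAfter-++ˡ c (concat (tabulate h)) (replicate r zero) j)

Distinguishable : (M σ n : ℕ) → Set
Distinguishable M σ n =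
  Σ[ T ∈ (Fin M → Str σ n) ] (∀ x y → SameRanks (T x) (T y) → x ≡ y)

-- An index below the stated power codes k functions `Fin h → Fin (suc h)`, each giving a shuffle of
-- 2h letters; `ι` then embeds these letters into the alphabet.
distinguishable-words : ∀ l k r → let h = suc l in h + h ≤ σ →
  Distinguishable ((suc h ^ h) ^ k) σ (triangle (h + h) + (k * (h + h) + r))
distinguishable-words {σ} l k r 2h≤σ = (λ x → map ι (word r (blocks x))) , λ x y same →
    finToFun-injective {suc h ^ h} {k} λ i →
    finToFun-injective {suc h} {h}
      (shuffle-injective (choices x i) (choices y i)
        (word-determined r (blocks x) (blocks y)
          (λ i → shuffle-balanced (choices x i)) (λ i → shuffle-balanced (choices y i))
          (λ j → trans (sym (specialRank-map ι-inj (word r (blocks x)) j))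
                   (trans (same j) (specialRank-map ι-inj (word r (blocks y)) j))) i))
  where
  h = suc l
  ι : Fin (h + h) → Fin σ
  ι a = inject≤ a 2h≤σ
  ι-inj : ∀ {a b} → ι a ≡ ι b → a ≡ b
  ι-inj {a} {b} = inject≤-injective 2h≤σ 2h≤σ a b
  choices : Fin ((suc h ^ h) ^ k) → Fin k → Fin h → Fin (suc h)
  choices x i = finToFun (finToFun x i)
  blocks : Fin ((suc h ^ h) ^ k) → Fin k → Str (h + h) (h + h)
  blocks x i = shuffle (choices x i)

-- Numbering of bit strings.

-- Bijective base-2 numeration, lowest digit first, with `false` as digit 1 and `true` as digit 2.
-- Without a digit 0, strings of different lengths receive different numbers.
bits→ℕᵇ : List Bool → ℕᵇ
bits→ℕᵇ []          = Binary.zero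
bits→ℕᵇ (false ∷ w) = 1+[2 bits→ℕᵇ w ]
bits→ℕᵇ (true ∷ w)  = 2[1+ bits→ℕᵇ w ]

bits→ℕᵇ-injective : ∀ {v w} → bits→ℕᵇ v ≡ bits→ℕᵇ w → v ≡ w
bits→ℕᵇ-injective {[]}        {[]}        eq = refl
bits→ℕᵇ-injective {false ∷ v} {false ∷ w} eq = cong (false ∷_) (bits→ℕᵇ-injective (1+[2_]-injective eq))
bits→ℕᵇ-injective {true ∷ v}  {true ∷ w}  eq = cong (true ∷_) (bits→ℕᵇ-injective (2[1+_]-injective eq))
bits→ℕᵇ-injective {[]}        {false ∷ w} ()
bits→ℕᵇ-injective {[]}        {true ∷ w}  ()
bits→ℕᵇ-injective {false ∷ v} {[]}        ()
bits→ℕᵇ-injective {false ∷ v} {true ∷ w}  ()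
bits→ℕᵇ-injective {true ∷ v}  {[]}        ()
bits→ℕᵇ-injective {true ∷ v}  {false ∷ w} ()

index : List Bool → ℕ
index w = Binary.toℕ (bits→ℕᵇ w)

index-injective : ∀ {v w} → index v ≡ index w → v ≡ w
index-injective = bits→ℕᵇ-injective ∘ Binaryₚ.toℕ-injective

-- Equality holds when all digits are 2: the largest index at length s is 2 ^ (s + 1) - 2.
2+index≤2^1+length : ∀ w → 2 + index w ≤ 2 ^ suc (length w)
2+index≤2^1+length []          = ≤-refl
2+index≤2^1+length (false ∷ w) = begin
  3 + 2 * index w          ≤⟨ n≤1+n _ ⟩
  4 + 2 * index w          ≡⟨ *-distribˡ-+ 2 2 (index w) ⟨
  2 * (2 + index w)        ≤⟨ *-monoʳ-≤ 2 (2+index≤2^1+length w) ⟩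
  2 * 2 ^ suc (length w)   ∎
  where open ≤-Reasoning
2+index≤2^1+length (true ∷ w) = begin
  2 + 2 * suc (index w)    ≡⟨ *-distribˡ-+ 2 1 (suc (index w)) ⟨
  2 * (2 + index w)        ≤⟨ *-monoʳ-≤ 2 (2+index≤2^1+length w) ⟩
  2 * 2 ^ suc (length w)   ∎
  where open ≤-Reasoning

-- From separated families to a space bound.

module _ (D : SpecialRankDS σ n) where
  open DataStructure D

  encode-separates : ∀ T U → encode T ≡ encode U → SameRanks T U
  encode-separates T U eq j =
    trans (sym (correct T j)) (trans (cong (λ w → answer w j) eq) (correct U j))

  -- Pigeonhole: if every word had 2 ^ (s + 1) ≤ N + 1, all indices would lie below N, and N + 1
  -- words would inject into `Fin N`.
  counting-bound : ∀ {N} → Distinguishable (suc N) σ n → ∃[ T ] suc N ℕ.< 2 ^ suc (space T)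
  counting-bound {N} (T , T-inj) with any? (λ x → suc N ℕ.<? 2 ^ suc (space (T x)))
  ... | yes (x , large) = T x , large
  ... | no  small       = contradiction (injective⇒≤ {f = f} f-inj) 1+n≰n
    where
    index<N : ∀ x → index (encode (T x)) ℕ.< N
    index<N x = ℕ.s≤s⁻¹ (≤-trans (2+index≤2^1+length (encode (T x))) (≮⇒≥ (λ lt → small (x , lt))))
    f : Fin (suc N) → Fin N
    f x = fromℕ< (index<N x)
    f-inj : ∀ {x y} → f x ≡ f y → x ≡ y
    f-inj {x} {y} eq = T-inj x y (encode-separates (T x) (T y) (index-injective
      (fromℕ<-injective _ _ (index<N x) (index<N y) eq)))

-- The factor 2 pays for replacing s + 1 by 2s. This needs s ≥ 1, which follows from 2 ≤ M < 2 ^ (s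
-- + 1).
space-bound : ∀ {M} e → 2 ≤ M → σ ^ n ≤ M ^ e → Distinguishable M σ n →
              (D : SpecialRankDS σ n) → ∃[ T ] σ ^ n ≤ 2 ^ (2 * e * DataStructure.space D T)
space-bound {σ} {n} {suc N} e 2≤M σ^n≤M^e dist D with counting-bound D dist
... | T , M<2^1+s = T , (begin
    σ ^ n                ≤⟨ σ^n≤M^e ⟩
    suc N ^ e            ≤⟨ ^-monoˡ-≤ e (<⇒≤ M<2^1+s) ⟩
    (2 ^ suc s) ^ e      ≡⟨ ^-*-assoc 2 (suc s) e ⟩
    2 ^ (suc s * e)      ≤⟨ ^-monoʳ-≤ 2 (*-monoˡ-≤ e (+-monoˡ-≤ s 1≤s)) ⟩
    2 ^ ((s + s) * e)    ≡⟨ cong (2 ^_) (rearrange s e) ⟩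
    2 ^ (2 * e * s)      ∎)
  where
  open ≤-Reasoning
  s = DataStructure.space D T
  1≤s : 1 ≤ s
  1≤s = n≢0⇒n>0 λ s≡0 →
    <⇒≱ (subst (λ t → suc N ℕ.< 2 ^ suc t) s≡0 M<2^1+s) 2≤M
  rearrange : ∀ s e → (s + s) * e ≡ 2 * e * s
  rearrange = solve-∀

-- Choice of the parameters and the resulting estimates.

triangle-formula : ∀ h → triangle (h + h) + h ≡ 2 * (h * h)
triangle-formula h = *-cancelˡ-≡ _ _ 2 (begin
  2 * (triangle (h + h) + h)       ≡⟨ distribute (triangle (h + h)) h ⟩
  2 * triangle (h + h) + (h + h)   ≡⟨ double (h + h) ⟩
  (h + h) * (h + h)                ≡⟨ square h ⟩
  2 * (2 * (h * h))                ∎)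
  where
  open ≡-Reasoning
  distribute : ∀ t h → 2 * (t + h) ≡ 2 * t + (h + h)
  distribute = solve-∀
  square : ∀ h → (h + h) * (h + h) ≡ 2 * (2 * (h * h))
  square = solve-∀
  step : ∀ t x → 2 * (t + x) + suc t ≡ 2 * x + t + (t + suc t)
  step = solve-∀
  expand : ∀ t → t * t + (t + suc t) ≡ suc t * suc t
  expand = solve-∀
  double : ∀ t → 2 * triangle t + t ≡ t * t
  double zero    = refl
  double (suc t) = trans (step t (triangle t))
    (trans (cong (_+ (t + suc t)) (double t)) (expand t))

-- Searches downwards from `k` for a place where `P` holds but fails at the successor.
last-true : {P : ℕ → Set} → Decidable P → P 0 → ∀ k → ¬ P k → ∃[ l ] P l × ¬ P (suc l)
last-true P? p zero    ¬pk = contradiction p ¬pk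
last-true P? p (suc k) ¬pk with P? k
... | yes pk  = k , pk , ¬pk
... | no  ¬pk = last-true P? p k ¬pk

-- If h + 1 = g fails, then either σ < 2g or σ ≤ n < 3g². Both give σ ≤ 4g², and g ≥ 2 turns this
-- into g ^ 4.
parameter : 2 ≤ σ → σ ≤ n → 3 ≤ n →
  ∃[ l ] let h = suc l in h + h ≤ σ × 3 * (h * h) ≤ n × σ ≤ suc h ^ 4
parameter {σ} {n} 2≤σ σ≤n 3≤n
  with last-true {P = λ l → suc l + suc l ≤ σ × 3 * (suc l * suc l) ≤ n}
         (λ l → (suc l + suc l ℕ.≤? σ) ×-dec (3 * (suc l * suc l) ℕ.≤? n))
         -- h = 1 is admissible, and l = σ is not, because 2 (σ + 1) exceeds σ.
         (2≤σ , 3≤n) σ (λ (2σ+2≤σ , _) → 1+n≰n (m+n≤o⇒m≤o (suc σ) 2σ+2≤σ))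
... | l , (2h≤σ , 3h²≤n) , maximal = l , 2h≤σ , 3h²≤n , bound
  where
  open ≤-Reasoning
  g = suc (suc l)
  2≤g : 2 ≤ g
  2≤g = s≤s (s≤s z≤n)
  from-four : ∀ {x} → x ≤ 4 * (g * g) → x ≤ g ^ 4
  from-four {x} x≤ = begin
    x                    ≤⟨ x≤ ⟩
    2 * 2 * (g * g)      ≤⟨ *-monoˡ-≤ (g * g) (*-mono-≤ 2≤g 2≤g) ⟩
    g * g * (g * g)      ≡⟨ fourth g ⟩
    g ^ 4                ∎
    where
    fourth : ∀ g → g * g * (g * g) ≡ g * (g * (g * (g * 1)))
    fourth = solve-∀
  bound : σ ≤ g ^ 4
  bound with g + g ℕ.≤? σ
  ... | yes 2g≤σ = from-four (begin
    σ               ≤⟨ σ≤n ⟩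
    n               ≤⟨ <⇒≤ (≰⇒> (λ 3g²≤n → maximal (2g≤σ , 3g²≤n))) ⟩
    3 * (g * g)     ≤⟨ *-monoˡ-≤ (g * g) (n≤1+n 3) ⟩
    4 * (g * g)     ∎)
  ... | no  2g≰σ = from-four (begin
    σ               ≤⟨ <⇒≤ (≰⇒> 2g≰σ) ⟩
    g + g           ≤⟨ +-mono-≤ (m≤m*n g g) (m≤m*n g g) ⟩
    g * g + g * g   ≤⟨ m≤m+n _ _ ⟩
    g * g + g * g + (g * g + g * g) ≡⟨ four (g * g) ⟩
    4 * (g * g)     ∎)
    where
    four : ∀ x → x + x + (x + x) ≡ 4 * x
    four = solve-∀

-- The staircase has length 2h² - h, so a string of length n ≥ 3h² leaves room
-- for c blocks of length 2h with h ≤ 2c, and these fill a constant fraction of it.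
block-count : ∀ l → let h = suc l in 3 * (h * h) ≤ n →
  ∃[ k ] ∃[ r ] n ≡ triangle (h + h) + (k * (h + h) + r) × n ≤ 7 * (h * k)
block-count {n} l 3h²≤n = c , r , n≡ , bound
  where
  open ≤-Reasoning
  h = suc l
  t = triangle (h + h)
  c = (n ∸ t) ℕ./ (h + h)
  r = (n ∸ t) ℕ.% (h + h)
  t≤n : t ≤ n
  t≤n = begin
    t              ≤⟨ m≤m+n t h ⟩
    t + h          ≡⟨ triangle-formula h ⟩
    2 * (h * h)    ≤⟨ *-monoˡ-≤ (h * h) (n≤1+n 2) ⟩
    3 * (h * h)    ≤⟨ 3h²≤n ⟩
    n              ∎
  n≡ : n ≡ t + (c * (h + h) + r)
  n≡ = trans (sym (m+[n∸m]≡n t≤n)) (cong (t +_)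
    (trans (m≡m%n+[m/n]*n (n ∸ t) (h + h)) (+-comm r (c * (h + h)))))
  n+h<2h²+2ch+2h : n + h ℕ.< 2 * (h * h) + (c * (h + h) + (h + h))
  n+h<2h²+2ch+2h = begin-strict
    n + h                                    ≡⟨ cong (_+ h) n≡ ⟩
    t + (c * (h + h) + r) + h                ≡⟨ shift t (c * (h + h) + r) h ⟩
    (t + h) + (c * (h + h) + r)              ≡⟨ cong (_+ (c * (h + h) + r)) (triangle-formula h) ⟩
    2 * (h * h) + (c * (h + h) + r)          <⟨ +-monoʳ-< (2 * (h * h)) (+-monoʳ-< (c * (h + h)) (m%n<n (n ∸ t) (h + h))) ⟩
    2 * (h * h) + (c * (h + h) + (h + h))    ∎
    where
    shift : ∀ x y z → x + y + z ≡ x + z + y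
    shift = solve-∀
  h≤2c : h ≤ 2 * c
  h≤2c = ℕ.s≤s⁻¹ (*-cancelˡ-< h h (suc (2 * c)) (+-cancelˡ-< (2 * (h * h) + h) _ _ (begin-strict
    2 * (h * h) + h + h * h                  ≡⟨ left h ⟩
    3 * (h * h) + h                          ≤⟨ +-monoˡ-≤ h 3h²≤n ⟩
    n + h                                    <⟨ n+h<2h²+2ch+2h ⟩
    2 * (h * h) + (c * (h + h) + (h + h))    ≡⟨ right h c ⟩
    2 * (h * h) + h + h * suc (2 * c)        ∎)))
    where
    left : ∀ h → 2 * (h * h) + h + h * h ≡ 3 * (h * h) + h
    left = solve-∀
    right : ∀ h c → 2 * (h * h) + (c * (h + h) + (h + h)) ≡ 2 * (h * h) + h + h * suc (2 * c)
    right = solve-∀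
  1≤c : 1 ≤ c
  1≤c = n≢0⇒n>0 λ c≡0 → 1+n≰n (≤-trans (s≤s z≤n) (subst (λ c → h ≤ 2 * c) c≡0 h≤2c))
  -- 7 = 4 + 2 + 1: h ≤ 2c gives 2h² ≤ 4hc, the blocks contribute 2hc, and 1 ≤ c bounds one h by hc.
  -- The other h cancels.
  bound : n ≤ 7 * (h * c)
  bound = +-cancelʳ-≤ h n (7 * (h * c)) (begin
    n + h                                     ≤⟨ <⇒≤ n+h<2h²+2ch+2h ⟩
    2 * (h * h) + (c * (h + h) + (h + h))     ≡⟨ split h c ⟩
    2 * (h * h) + 2 * (h * c) + h * 1 + h     ≤⟨ +-monoˡ-≤ h (+-mono-≤ (+-monoˡ-≤ (2 * (h * c)) (*-monoʳ-≤ 2 (*-monoʳ-≤ h h≤2c))) (*-monoʳ-≤ h 1≤c)) ⟩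
    2 * (h * (2 * c)) + 2 * (h * c) + h * c + h  ≡⟨ collect h c ⟩
    7 * (h * c) + h                           ∎)
    where
    split : ∀ h c → 2 * (h * h) + (c * (h + h) + (h + h)) ≡ 2 * (h * h) + 2 * (h * c) + h * 1 + h
    split = solve-∀
    collect : ∀ h c → 2 * (h * (2 * c)) + 2 * (h * c) + h * c + h ≡ 7 * (h * c) + h
    collect = solve-∀

power-bound : ∀ g h k a b → .{{_ : ℕ.NonZero g}} → σ ≤ g ^ a → n ≤ b * (h * k) →
              σ ^ n ≤ ((g ^ h) ^ k) ^ (a * b)
power-bound {σ} {n} g h k a b σ≤ n≤ = begin
  σ ^ n                        ≤⟨ ^-monoˡ-≤ n σ≤ ⟩
  (g ^ a) ^ n                  ≡⟨ ^-*-assoc g a n ⟩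
  g ^ (a * n)                  ≤⟨ ^-monoʳ-≤ g (*-monoʳ-≤ a n≤) ⟩
  g ^ (a * (b * (h * k)))      ≡⟨ cong (g ^_) (rearrange a b (h * k)) ⟩
  g ^ (h * k * (a * b))        ≡⟨ ^-*-assoc g (h * k) (a * b) ⟨
  (g ^ (h * k)) ^ (a * b)      ≡⟨ cong (_^ (a * b)) (^-*-assoc g h k) ⟨
  ((g ^ h) ^ k) ^ (a * b)      ∎
  where
  open ≤-Reasoning
  rearrange : ∀ a b c → a * (b * c) ≡ c * (a * b)
  rearrange = solve-∀

2≤[g^h]^k : ∀ g h k → 2 ≤ g → 1 ≤ h * k → 2 ≤ (g ^ h) ^ k
2≤[g^h]^k g h k 2≤g 1≤hk = begin
  2            ≤⟨ 2≤g ⟩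
  g            ≡⟨ ^-identityʳ g ⟨
  g ^ 1        ≤⟨ ^-monoʳ-≤ g {{ℕ.>-nonZero (<⇒≤ 2≤g)}} {1} {h * k} 1≤hk ⟩
  g ^ (h * k)  ≡⟨ ^-*-assoc g h k ⟨
  (g ^ h) ^ k  ∎
  where open ≤-Reasoning

many-words : 2 ≤ σ → σ ≤ n → 3 ≤ n →
  ∃[ M ] 2 ≤ M × σ ^ n ≤ M ^ 28 × Distinguishable M σ n
many-words {σ} {n} 2≤σ σ≤n 3≤n =
  let l , 2h≤σ , 3h²≤n , σ≤g⁴ = parameter 2≤σ σ≤n 3≤n
      k , r , n≡ , n≤7hk      = block-count l 3h²≤n
      h                       = suc l
      g                       = suc h
      1≤hk : 1 ≤ h * k
      1≤hk = n≢0⇒n>0 λ hk≡0 →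
        <⇒≱ (s≤s (subst (λ x → n ≤ 7 * x) hk≡0 n≤7hk)) (≤-trans (s≤s z≤n) 3≤n)
  in (g ^ h) ^ k , 2≤[g^h]^k g h k (s≤s (s≤s z≤n)) 1≤hk , power-bound g h k 4 7 σ≤g⁴ n≤7hk ,
     subst (Distinguishable ((g ^ h) ^ k) σ) (sym n≡) (distinguishable-words l k r 2h≤σ)

-- The remaining case and the conclusion.

-- The words 00 and 01 have ranks 2 and 1 at the second position.
two-words : Distinguishable 2 2 2
two-words = words , separated
  where
  words : Fin 2 → Str 2 2
  words x = zero ∷ x ∷ []
  separated : ∀ x y → SameRanks (words x) (words y) → x ≡ y
  separated zero       zero       same = refl
  separated zero       (suc zero) same = contradiction (same (suc zero)) λ ()
  separated (suc zero) zero       same = contradiction (same (suc zero)) λ ()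
  separated (suc zero) (suc zero) same = refl

theorem2p1 : ∃[ δ ] 0ℚ < δ ×
    (∀ (σ n : ℕ) → 2 ≤ σ → σ ≤ n →
    (D : SpecialRankDS σ n) →
    ∃[ T ] DataStructure.space D T ≥[ δ ] n log₂ σ)
-- 56 = 2 · 28: the exponent 28 = 4 · 7 comes from σ ≤ g ^ 4 and n ≤ 7hk, the factor 2 from s + 1 ≤
-- 2s.
theorem2p1 = ℤ.+ 1 / 56 , positive⁻¹ (ℤ.+ 1 / 56) , bound
  where
  exponential : ∀ σ n → 2 ≤ σ → σ ≤ n → (D : SpecialRankDS σ n) →
                ∃[ T ] σ ^ n ≤ 2 ^ (2 * 28 * DataStructure.space D T)
  exponential σ n 2≤σ σ≤n D with 3 ℕ.≤? n
  ... | yes 3≤n = let M , 2≤M , σ^n≤M^28 , words = many-words 2≤σ σ≤n 3≤n in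
                  space-bound 28 2≤M σ^n≤M^28 words D
  -- Here n ≤ 2, so 2 ≤ σ ≤ n forces σ = n = 2.
  ... | no  3≰n with ≤-antisym (≤-trans σ≤n (ℕ.s≤s⁻¹ (≰⇒> 3≰n))) 2≤σ
  ...   | refl with ≤-antisym σ≤n (ℕ.s≤s⁻¹ (≰⇒> 3≰n))
  ...     | refl = space-bound 28 ≤-refl (^-monoʳ-≤ 2 {2} {28} (s≤s (s≤s z≤n))) two-words D
  bound : ∀ σ n → 2 ≤ σ → σ ≤ n → (D : SpecialRankDS σ n) →
          ∃[ T ] DataStructure.space D T ≥[ ℤ.+ 1 / 56 ] n log₂ σ
  bound σ n 2≤σ σ≤n D with exponential σ n 2≤σ σ≤n D
  ... | T , σ^n≤ = T , subst (λ e → σ ^ e ≤ 2 ^ (56 * DataStructure.space D T))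
                             (sym (*-identityˡ n)) σ^n≤
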